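{- If $G$ is an opposable finite simple graph and $H$ is any finite simple graph, then the Cartesian product $G\square H$, the strong product $G\boxtimes H$, the tensor product $G\times H$, the lexicographic product $G\bullet H$, the co-normal product $G*H$, and the homomorphic product $G\ltimes H$ are all opposable.
   Context: All graphs are finite and simple. $N[v]$ denotes the closed neighbourhood of $v$. An opposition of a graph $G$ is an automorphism $f$ of $G$ of order two, in the sense $f\circ f=\mathrm{id}$, such that $f(v)\notin N[v]$ for all $v\in V(G)$. A graph is opposable if it has an opposition (the empty graph is vacuously opposable). Each product has vertex set $V(G)\times V(H)$, and distinct vertices $(g_1,h_1)$ and $(g_2,h_2)$ are adjacent if and only if the following holds: - Cartesian $G\square H$: $(g_1=g_2\wedge h_1h_2\in E(H))\vee(g_1g_2\in E(G)\wedge h_1=h_2)$. - Strong $G\boxtimes H$: $(g_1=g_2\wedge h_1h_2\in E(H))\vee(g_1g_2\in E(G)\wedge h_1=h_2)\vee(g_1g_2\in E(G)\wedge h_1h_2\in E(H))$. - Tensor $G\times H$: $g_1g_2\in E(G)\wedge h_1h_2\in E(H)$. - Lexicographic $G\bullet H$: $g_1g_2\in E(G)\vee(g_1=g_2\wedge h_1h_2\in E(H))$. - Co-normal $G*H$: $g_1g_2\in E(G)\vee h_1h_2\in E(H)$. - Homomorphic $G\ltimes H$: $g_1=g_2\vee(g_1g_2\in E(G)\wedge\neg(h_1h_2\in E(H)))$. -}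

module Defs where

open import Data.Fin using (Fin)
import Data.Fin.Properties as Fin
open import Data.Product using (_×_; _,_; proj₁; proj₂; ∃-syntax)
open import Data.Product.Function.NonDependent.Propositional using (_×-↔_)
open import Data.Sum using (_⊎_; inj₁; inj₂)
import Data.Sum as Sum
open import Function using (_∘_)
open import Function.Bundles using (_↔_; _⇔_)
open import Function.Definitions using (Bijective)
open import Function.Properties.Inverse using (↔-sym; ↔-trans; ↔⇒↣)
open import Level using (0ℓ)
open import Relation.Binary.Core using (Rel)
open import Relation.Binary.Definitions
  using (Symmetric; Irreflexive; Decidable; DecidableEquality)
open import Relation.Binary.PropositionalEquality using (_≡_; _≢_; sym; ≢-sym)
open import Relation.Nullary using (¬_)
open import Relation.Nullary.Decidable using (_×-dec_; _⊎-dec_; ¬?)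
open import Relation.Unary using (Pred; _∉_)

Finite : Set → Set
Finite A = ∃[ n ] (A ↔ Fin n)

-- Adjacency is required to be decidable: constructively this is part of a
-- finite graph being given by a set of edges; classically it is no restriction.
record Graph : Set₁ where
  field
    V      : Set
    finite : Finite V
    E      : Rel V 0ℓ
    E?     : Decidable E
    symm   : Symmetric E
    irrefl : Irreflexive _≡_ E

  _≟_ : DecidableEquality V
  _≟_ = Fin.inj⇒≟ (↔⇒↣ (proj₂ finite))

  N[_] : V → Pred V 0ℓ
  N[ v ] u = u ≡ v ⊎ E v u

module _ (G : Graph) where
  open Graph G

  record IsAutomorphism (f : V → V) : Set where
    field
      bijective : Bijective _≡_ _≡_ f
      adjacency : ∀ u v → E u v ⇔ E (f u) (f v)

  record IsOpposition (f : V → V) : Set where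
    field
      isAutomorphism : IsAutomorphism f
      involutive     : ∀ v → f (f v) ≡ v
      opposing       : ∀ v → f v ∉ N[ v ]

  Opposable : Set
  Opposable = ∃[ f ] IsOpposition f

module _ (G H : Graph) where
  private
    module G = Graph G
    module H = Graph H

  -- The graph on V(G) × V(H) in which distinct vertices p and q are adjacent
  -- exactly when R p q holds.
  productGraph : (R : Rel (G.V × H.V) 0ℓ) → Decidable R → Symmetric R → Graph
  productGraph R R? R-sym = record
    { V      = G.V × H.V
    ; finite = _ , ↔-trans (proj₂ G.finite ×-↔ proj₂ H.finite) (↔-sym Fin.*↔×)
    ; E      = λ p q → p ≢ q × R p q
    ; E?     = λ p q → ¬? (p ≟ᴾ q) ×-dec R? p q
    ; symm   = λ (p≢q , r) → ≢-sym p≢q , R-sym r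
    ; irrefl = λ p≡q (p≢q , _) → p≢q p≡q
    }
    where
    open import Data.Product.Properties using (≡-dec)
    _≟ᴾ_ : DecidableEquality (G.V × H.V)
    _≟ᴾ_ = ≡-dec G._≟_ H._≟_

  CartesianAdj StrongAdj TensorAdj LexicographicAdj CoNormalAdj HomomorphicAdj :
    Rel (G.V × H.V) 0ℓ
  CartesianAdj (g₁ , h₁) (g₂ , h₂) =
    (g₁ ≡ g₂ × H.E h₁ h₂) ⊎ (G.E g₁ g₂ × h₁ ≡ h₂)
  StrongAdj (g₁ , h₁) (g₂ , h₂) =
    (g₁ ≡ g₂ × H.E h₁ h₂) ⊎ (G.E g₁ g₂ × h₁ ≡ h₂) ⊎ (G.E g₁ g₂ × H.E h₁ h₂)
  TensorAdj (g₁ , h₁) (g₂ , h₂) =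
    G.E g₁ g₂ × H.E h₁ h₂
  LexicographicAdj (g₁ , h₁) (g₂ , h₂) =
    G.E g₁ g₂ ⊎ (g₁ ≡ g₂ × H.E h₁ h₂)
  CoNormalAdj (g₁ , h₁) (g₂ , h₂) =
    G.E g₁ g₂ ⊎ H.E h₁ h₂
  HomomorphicAdj (g₁ , h₁) (g₂ , h₂) =
    g₁ ≡ g₂ ⊎ (G.E g₁ g₂ × ¬ H.E h₁ h₂)

  infixl 7 _□_ _⊠_ _⊗_ _•_ _∗_ _⋉_

  _□_ : Graph
  _□_ = productGraph CartesianAdj
    (λ (g₁ , h₁) (g₂ , h₂) →
      (g₁ G.≟ g₂ ×-dec H.E? h₁ h₂) ⊎-dec (G.E? g₁ g₂ ×-dec h₁ H.≟ h₂))
    λ { (inj₁ (p , e)) → inj₁ (sym p , H.symm e)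
      ; (inj₂ (e , p)) → inj₂ (G.symm e , sym p) }

  _⊠_ : Graph
  _⊠_ = productGraph StrongAdj
    (λ (g₁ , h₁) (g₂ , h₂) →
      (g₁ G.≟ g₂ ×-dec H.E? h₁ h₂) ⊎-dec
      (G.E? g₁ g₂ ×-dec h₁ H.≟ h₂) ⊎-dec
      (G.E? g₁ g₂ ×-dec H.E? h₁ h₂))
    λ { (inj₁ (p , e))        → inj₁ (sym p , H.symm e)
      ; (inj₂ (inj₁ (e , p))) → inj₂ (inj₁ (G.symm e , sym p))
      ; (inj₂ (inj₂ (e , d))) → inj₂ (inj₂ (G.symm e , H.symm d)) }

  _⊗_ : Graph
  _⊗_ = productGraph TensorAdj
    (λ (g₁ , h₁) (g₂ , h₂) → G.E? g₁ g₂ ×-dec H.E? h₁ h₂)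
    λ (e , d) → G.symm e , H.symm d

  _•_ : Graph
  _•_ = productGraph LexicographicAdj
    (λ (g₁ , h₁) (g₂ , h₂) →
      G.E? g₁ g₂ ⊎-dec (g₁ G.≟ g₂ ×-dec H.E? h₁ h₂))
    λ { (inj₁ e)       → inj₁ (G.symm e)
      ; (inj₂ (p , e)) → inj₂ (sym p , H.symm e) }

  _∗_ : Graph
  _∗_ = productGraph CoNormalAdj
    (λ (g₁ , h₁) (g₂ , h₂) → G.E? g₁ g₂ ⊎-dec H.E? h₁ h₂)
    (Sum.map G.symm H.symm)

  _⋉_ : Graph
  _⋉_ = productGraph HomomorphicAdj
    (λ (g₁ , h₁) (g₂ , h₂) →
      g₁ G.≟ g₂ ⊎-dec (G.E? g₁ g₂ ×-dec ¬? (H.E? h₁ h₂)))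
    λ { (inj₁ p)        → inj₁ (sym p)
      ; (inj₂ (e , ¬d)) → inj₂ (G.symm e , ¬d ∘ H.symm) }

{-# OPTIONS --safe #-}
module Submission where

open import Algebra.Consequences.Propositional using (selfInverse⇒bijective)
open import Data.Product using (_×_; _,_; proj₁; proj₂; map₁)
open import Data.Sum using (inj₁; inj₂; [_,_])
import Data.Sum as Sum
open import Function using (_∘_)
open import Function.Bundles using (Equivalence; mk⇔)
open import Function.Definitions using (Injective)
open import Level using (0ℓ)
open import Relation.Binary.Core using (Rel; _=[_]⇒_)
open import Relation.Binary.Definitions using (Decidable; Symmetric)
open import Relation.Binary.PropositionalEquality
  using (_≡_; refl; sym; cong; cong₂; subst₂)
open import Relation.Nullary using (¬_)
open import Relation.Unary using (_∉_)
open import Defs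

-- An opposition f of G acts on the first coordinate as (g , h) ↦ (f g , h).
-- Every product adjacency is built from the relations g₁ ≡ g₂ and E g₁ g₂, which
-- f preserves, and relations on the unchanged second coordinates.  Adjacency of
-- (g , h) and (f g , h) would need f g ∈ N[ g ] or a loop at h.

module _ (G : Graph) where
  open Graph G

  -- An involution is its own inverse, hence bijective. Applying `f` once more to an edge between
  -- `f u` and `f v` gives back the edge between `u` and `v`, so preserving edges already implies
  -- reflecting them.
  preserving-involution⇒opposition : ∀ {f} →
    (∀ v → f (f v) ≡ v) → E =[ f ]⇒ E → (∀ v → f v ∉ N[ v ]) →
    IsOpposition G f
  preserving-involution⇒opposition {f} f∘f f-pres f-opp = record
    { isAutomorphism = record
      { bijective = selfInverse⇒bijective λ { refl → f∘f _ }
      ; adjacency = λ u v →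
          mk⇔ f-pres (subst₂ E (f∘f u) (f∘f v) ∘ f-pres)
      }
    ; involutive = f∘f
    ; opposing   = f-opp
    }

module FirstCoordinate (G H : Graph)
  {f : Graph.V G → Graph.V G} (f-opp : IsOpposition G f) where
  private
    module G = Graph G
    module H = Graph H
  open IsOpposition f-opp
  open IsAutomorphism isAutomorphism

  E-pres : G.E =[ f ]⇒ G.E
  E-pres = Equivalence.to (adjacency _ _)

  no-fixpoint : ∀ {g} → ¬ g ≡ f g
  no-fixpoint = opposing _ ∘ inj₁ ∘ sym

  no-edge : ∀ {g} → ¬ G.E g (f g)
  no-edge = opposing _ ∘ inj₂

  no-loop : ∀ {h} → ¬ H.E h h
  no-loop = H.irrefl refl

  -- Product edges carry a proof that their ends differ; this keeps the images distinct.
  map₁-injective : Injective _≡_ _≡_ (map₁ {C = H.V} f)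
  map₁-injective eq =
    cong₂ _,_ (proj₁ bijective (cong proj₁ eq)) (cong proj₂ eq)

  -- Reduces each product to two checks on its bare relation `R`; the distinctness of ends is
  -- handled here once for all six.
  productGraph-opposable : {R : Rel (G.V × H.V) 0ℓ}
    {R? : Decidable R} {R-sym : Symmetric R} →
    R =[ map₁ f ]⇒ R → (∀ {g h} → ¬ R (g , h) (f g , h)) →
    Opposable (productGraph G H R R? (λ {p} {q} → R-sym {p} {q}))
  productGraph-opposable R-pres ¬R =
    map₁ f , preserving-involution⇒opposition _
      (λ (g , h) → cong (_, h) (involutive g))
      (λ (p≢q , r) → p≢q ∘ map₁-injective , R-pres r)
      (λ _ → [ no-fixpoint ∘ sym ∘ cong proj₁ , ¬R ∘ proj₂ ])

corollary2p7 : (G H : Graph) → Opposable G →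
    Opposable (G □ H) × Opposable (G ⊠ H) × Opposable (G ⊗ H) ×
    Opposable (G • H) × Opposable (G ∗ H) × Opposable (G ⋉ H)
corollary2p7 G H (f , f-opp) =
    productGraph-opposable
      (Sum.map (map₁ (cong f)) (map₁ E-pres))
      [ no-fixpoint ∘ proj₁ , no-edge ∘ proj₁ ]
  , productGraph-opposable
      (Sum.map (map₁ (cong f)) (Sum.map (map₁ E-pres) (map₁ E-pres)))
      [ no-fixpoint ∘ proj₁ , [ no-edge ∘ proj₁ , no-edge ∘ proj₁ ] ]
  , productGraph-opposable (map₁ E-pres) (no-edge ∘ proj₁)
  , productGraph-opposable (Sum.map E-pres (map₁ (cong f))) [ no-edge , no-fixpoint ∘ proj₁ ]
  -- An `H`-edge here leaves the first coordinates unconstrained, so looplessness of `H` must rule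
  -- it out.
  , productGraph-opposable (Sum.map₁ E-pres) [ no-edge , no-loop ]
  -- `¬ H.E h h` always holds, so the contradiction in the second case has to come from `G`.
  , productGraph-opposable (Sum.map (cong f) (map₁ E-pres)) [ no-fixpoint , no-edge ∘ proj₁ ]
  where open FirstCoordinate G H f-opp
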